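{- There is no $\mathrm{SA}+\mathrm{Squares}$ refutation of the unary $\mathrm{LNP}_n$ of degree at most $(n-3)/2$.
   Context: Unary $\mathrm{LNP}_n$ as linear inequalities in variables $P_{i,j},S_{i,j}$ ($i,j\in[n]$): $P_{i,i}=0$ ($i\in[n]$); $P_{i,k}-P_{i,j}-P_{j,k}+1\ge 0$ ($i,j,k\in[n]$); $P_{i,j}-S_{i,j}\ge0$ ($i,j\in[n]$); $\sum_{i\in[n]}S_{i,j}-1\ge 0$ ($j\in[n]$). An equality $a=0$ is treated as the two inequalities $a\ge0$, $-a\ge0$. $\mathrm{SA}+\mathrm{Squares}$: polynomials are multilinear, i.e. all products are reduced using $x^2=x$ for every variable. A degree-$d$ $\mathrm{SA}+\mathrm{Squares}$ refutation of linear inequalities $q_1\ge0,\dots,q_x\ge0$ is an identity (of multilinearised polynomials) $-1=\sum_{i=1}^x p_iq_i+\sum_{i=1}^y r_i^2$, where each $p_i$ is a polynomial with nonnegative coefficients, $r_i$ are arbitrary real polynomials, and every $p_iq_i$ and $r_i^2$ has degree at most $d$. -}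

module Defs where

open import Level using (Level; _⊔_) renaming (suc to lsuc)
open import Data.Nat using (ℕ; zero; suc; _<_)
import Data.Nat as ℕ
open import Data.Bool using (Bool; true; false; if_then_else_)
open import Data.Fin using (Fin; _↑ˡ_; _↑ʳ_; combine)
open import Data.Fin.Subset using (Subset; ⊥; ⁅_⁆; _∪_; ∣_∣)
open import Data.Vec using (Vec; []; _∷_)
import Data.Vec.Properties as VecP
import Data.Bool.Properties as BoolP
open import Data.List using (List; []; _∷_; map; concatMap; foldr)
open import Data.Product using (Σ; ∃; _×_; _,_)
open import Relation.Nullary using (¬_; does)
open import Relation.Binary using (Rel; IsTotalOrder)
open import Algebra.Bundles using (CommutativeRing)
open import Data.List.Membership.Propositional using (_∈_)

record OrderedField (c ℓ : Level) : Set (lsuc (c ⊔ ℓ)) where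
  field
    commutativeRing : CommutativeRing c ℓ
  open CommutativeRing commutativeRing public
  field
    _≤_          : Rel Carrier ℓ
    isTotalOrder : IsTotalOrder _≈_ _≤_
    +-mono-≤     : ∀ {x y} z → x ≤ y → (x + z) ≤ (y + z)
    *-nonneg     : ∀ {x y} → 0# ≤ x → 0# ≤ y → 0# ≤ (x * y)
    0≉1          : ¬ (0# ≈ 1#)
    inverse      : ∀ x → ¬ (x ≈ 0#) → ∃ λ y → (x * y) ≈ 1#

subsets : (m : ℕ) → List (Subset m)
subsets zero    = [] ∷ []
subsets (suc m) = concatMap (λ s → (false ∷ s) ∷ (true ∷ s) ∷ []) (subsets m)

_≟S_ : ∀ {m} (s t : Subset m) → Bool
s ≟S t = does (VecP.≡-dec BoolP._≟_ s t)

NVars : ℕ → ℕ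
NVars n = n ℕ.* n ℕ.+ n ℕ.* n

varP : ∀ {n} → Fin n → Fin n → Fin (NVars n)
varP {n} i j = combine i j ↑ˡ (n ℕ.* n)

varS : ∀ {n} → Fin n → Fin n → Fin (NVars n)
varS {n} i j = (n ℕ.* n) ↑ʳ combine i j

-- Multilinear polynomials over an ordered field in m variables:
-- a coefficient for every monomial (= subset of the variables).
-- Products are multilinearised: x_A · x_B = x_{A ∪ B}.

module Multilinear {c ℓ} (F : OrderedField c ℓ) (m : ℕ) where
  open OrderedField F

  Poly : Set c
  Poly = Subset m → Carrier

  sumL : List Carrier → Carrier
  sumL = foldr _+_ 0#

  const : Carrier → Poly
  const a T = if T ≟S ⊥ then a else 0#

  var : Fin m → Poly
  var v T = if T ≟S ⁅ v ⁆ then 1# else 0#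

  _+P_ : Poly → Poly → Poly
  (p +P q) T = p T + q T

  -P_ : Poly → Poly
  (-P p) T = - (p T)

  _*P_ : Poly → Poly → Poly
  (p *P q) T = sumL (concatMap (λ A → map (λ B →
                 if (A ∪ B) ≟S T then p A * q B else 0#) (subsets m)) (subsets m))

  0P : Poly
  0P = const 0#

  sumP : List Poly → Poly
  sumP = foldr _+P_ 0P

  _≈P_ : Poly → Poly → Set ℓ
  p ≈P q = ∀ T → p T ≈ q T

  DegreeAtMost : ℕ → Poly → Set ℓ
  DegreeAtMost d p = ∀ T → d < ∣ T ∣ → p T ≈ 0#

  NonnegCoeffs : Poly → Set ℓ
  NonnegCoeffs p = ∀ T → 0# ≤ p T

-- The axioms of unary LNP_n, each an inequality q ≥ 0.
-- P_{i,i} = 0 is split into P_{i,i} ≥ 0 and -P_{i,i} ≥ 0.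

data LNPAxiom (n : ℕ) : Set where
  diag≥   : Fin n → LNPAxiom n
  diag≤   : Fin n → LNPAxiom n
  trans   : Fin n → Fin n → Fin n → LNPAxiom n
  PS      : Fin n → Fin n → LNPAxiom n
  sumS    : Fin n → LNPAxiom n

allFinL : (n : ℕ) → List (Fin n)
allFinL zero    = []
allFinL (suc n) = Fin.zero ∷ map Fin.suc (allFinL n)
  where import Data.Fin as Fin

module LNP {c ℓ} (F : OrderedField c ℓ) (n : ℕ) where
  open OrderedField F
  open Multilinear F (NVars n) public

  P : Fin n → Fin n → Poly
  P i j = var (varP i j)

  S : Fin n → Fin n → Poly
  S i j = var (varS i j)

  axiomPoly : LNPAxiom n → Poly
  axiomPoly (diag≥ i)     = P i i
  axiomPoly (diag≤ i)     = -P (P i i)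
  axiomPoly (trans i j k) = ((P i k +P (-P (P i j))) +P (-P (P j k))) +P const 1#
  axiomPoly (PS i j)      = P i j +P (-P (S i j))
  axiomPoly (sumS j)      = sumP (map (λ i → S i j) (allFinL n)) +P (-P (const 1#))

  record SASquaresRefutation (d : ℕ) : Set (c ⊔ ℓ) where
    field
      linTerms    : List (LNPAxiom n × Poly)
      squares     : List Poly
      nonneg      : ∀ {a p} → (a , p) ∈ linTerms → NonnegCoeffs p
      degLin      : ∀ {a p} → (a , p) ∈ linTerms → DegreeAtMost d (p *P axiomPoly a)
      degSq       : ∀ {r} → r ∈ squares → DegreeAtMost d (r *P r)
      identity    : const (- 1#) ≈P
                      (sumP (map (λ { (a , p) → p *P axiomPoly a }) linTerms)
                        +P sumP (map (λ r → r *P r) squares))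

-- The refutation is defeated by a genuine probability distribution: a uniformly random linear
-- order on [n], with P_{i,j} = S_{i,j} = 1 exactly when i comes before j. Squares and all axioms
-- but ∑ᵢ S_{i,j} ≥ 1 are then nonnegative pointwise. For that one, condition on a monomial x_T with
-- |T| ≤ d. If o ≠ j is not the second index of a variable of T, then moving o forward preserves
-- x_T, so among the n positions at which o can be inserted into an order of the other elements, the
-- admissible ones form an initial segment; hence o precedes j with conditional probability at
-- least (r + 1) / n, where r is the number of the other elements before j. Summing over the at
-- least n - d - 1 such o shows that j has on average at least (n - d - 1) / (d + 2) ≥ 1
-- predecessors. A monomial x_T with |T| > d and no S_{i,j} in T cannot occur in the multiplier,
-- because its coefficient -p_T in the product is not cancelled.
module Submission where

open import Defs
open import Data.Nat using (ℕ; _+_; _*_; _≤_)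
open import Relation.Nullary using (¬_)

open import Algebra.Bundles using (CommutativeSemiring)
import Algebra.Properties.CommutativeSemigroup as CommutativeSemigroupProperties
import Algebra.Properties.Ring as RingProperties
open import Data.Bool using (Bool; true; false; if_then_else_)
import Data.Bool.Properties as Bool
open import Data.Empty using (⊥-elim)
open import Data.Fin using (Fin; splitAt; remQuot; combine)
import Data.Fin.Properties as Fin
open import Data.Fin.Subset using (Subset; ⊥; ⁅_⁆; _∪_; ∣_∣; _⊆_) renaming (_∈_ to _∈ˢ_)
import Data.Fin.Subset.Properties as Subset
open import Data.List using (List; []; _∷_; _++_; map; concatMap; foldr; length; allFin)
import Data.List.Properties as List
open import Data.List.Membership.Propositional using (_∈_; find; lose)
open import Data.List.Membership.Propositional.Properties
  using (∈-map⁺; ∈-map⁻; ∈-concatMap⁺; ∈-concatMap⁻; ∈-∃++; ∈-allFin)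
open import Data.List.Relation.Binary.Permutation.Propositional as Permutation using (_↭_; prep; swap)
open import Data.List.Relation.Binary.Permutation.Propositional.Properties using (shift; ↭-length)
import Data.List.Relation.Unary.All as All
open import Data.List.Relation.Unary.AllPairs using ([]; _∷_)
open import Data.List.Relation.Unary.Any using (here; there)
open import Data.List.Relation.Unary.Unique.Propositional using (Unique)
import Data.List.Relation.Unary.Unique.Propositional.Properties as Unique
open import Data.Nat using (zero; suc; _∸_; _<_; _<ᵇ_; z≤n; s≤s; >-nonZero)
import Data.Nat.Properties as ℕ
open import Data.Nat.Solver using (module +-*-Solver)
open import Data.Product using (∃; _×_; _,_; proj₁; proj₂)
open import Data.Sum using (inj₁; inj₂; [_,_]′)
import Data.Vec as Vec
import Data.Vec.Properties as Vec
open import Function using (_∘_; id; mk⇔)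
open import Level using (Level)
open import Relation.Binary using (DecidableEquality; IsTotalOrder)
open import Relation.Binary.PropositionalEquality as ≡ using (_≡_; _≢_; refl; cong; cong₂; subst)
open import Relation.Nullary using (yes; no; does)
import Relation.Nullary.Decidable as Dec

open +-*-Solver using (solve; con; _:+_; _:*_; _:=_)

private variable
  a : Level
  A B : Set a

-- Finite sums over lists in a commutative semiring

module ListSum {c ℓ} (R : CommutativeSemiring c ℓ) where
  open CommutativeSemiring R renaming (_+_ to _⊕_; _*_ to _⊗_; refl to ≈-refl; sym to ≈-sym; trans to ≈-trans)
  open CommutativeSemigroupProperties +-commutativeSemigroup using (interchange)
  open import Relation.Binary.Reasoning.Setoid setoid

  sum : List Carrier → Carrier
  sum = foldr _⊕_ 0#

  ∑ : List A → (A → Carrier) → Carrier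
  ∑ xs f = sum (map f xs)

  sum-++ : ∀ xs ys → sum (xs ++ ys) ≈ sum xs ⊕ sum ys
  sum-++ []       ys = ≈-sym (+-identityˡ _)
  sum-++ (x ∷ xs) ys = ≈-trans (+-congˡ (sum-++ xs ys)) (≈-sym (+-assoc _ _ _))

  sum-concatMap : (g : A → List Carrier) (xs : List A) →
                  sum (concatMap g xs) ≈ ∑ xs (sum ∘ g)
  sum-concatMap g []       = ≈-refl
  sum-concatMap g (x ∷ xs) = ≈-trans (sum-++ (g x) _) (+-congˡ (sum-concatMap g xs))

  ∑-concatMap : (g : A → List B) (xs : List A) (f : B → Carrier) →
                ∑ (concatMap g xs) f ≈ ∑ xs (λ x → ∑ (g x) f)
  ∑-concatMap g xs f = begin
    sum (map f (concatMap g xs))    ≡⟨ cong sum (List.map-concatMap f g xs) ⟩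
    sum (concatMap (map f ∘ g) xs)  ≈⟨ sum-concatMap (map f ∘ g) xs ⟩
    ∑ xs (λ x → ∑ (g x) f)          ∎

  ∑-map : (g : A → B) (xs : List A) (f : B → Carrier) → ∑ (map g xs) f ≡ ∑ xs (f ∘ g)
  ∑-map g xs f = cong sum (≡.sym (List.map-∘ xs))

  ∑-cong-∈ : (xs : List A) {f g : A → Carrier} → (∀ {x} → x ∈ xs → f x ≈ g x) → ∑ xs f ≈ ∑ xs g
  ∑-cong-∈ []       eq = ≈-refl
  ∑-cong-∈ (x ∷ xs) eq = +-cong (eq (here refl)) (∑-cong-∈ xs (eq ∘ there))

  ∑-cong : (xs : List A) {f g : A → Carrier} → (∀ x → f x ≈ g x) → ∑ xs f ≈ ∑ xs g
  ∑-cong xs eq = ∑-cong-∈ xs (λ {x} _ → eq x)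

  ∑-zero : (xs : List A) {f : A → Carrier} → (∀ x → f x ≈ 0#) → ∑ xs f ≈ 0#
  ∑-zero []       eq = ≈-refl
  ∑-zero (x ∷ xs) eq = ≈-trans (+-cong (eq x) (∑-zero xs eq)) (+-identityˡ 0#)

  ∑-+ : (xs : List A) (f g : A → Carrier) → ∑ xs (λ x → f x ⊕ g x) ≈ ∑ xs f ⊕ ∑ xs g
  ∑-+ []       f g = ≈-sym (+-identityˡ 0#)
  ∑-+ (x ∷ xs) f g = ≈-trans (+-congˡ (∑-+ xs f g)) (interchange _ _ _ _)

  ∑-*ˡ : (xs : List A) (k : Carrier) (f : A → Carrier) → ∑ xs (λ x → k ⊗ f x) ≈ k ⊗ ∑ xs f
  ∑-*ˡ []       k f = ≈-sym (zeroʳ k)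
  ∑-*ˡ (x ∷ xs) k f = ≈-trans (+-congˡ (∑-*ˡ xs k f)) (≈-sym (distribˡ k _ _))

  ∑-*ʳ : (xs : List A) (k : Carrier) (f : A → Carrier) → ∑ xs (λ x → f x ⊗ k) ≈ ∑ xs f ⊗ k
  ∑-*ʳ xs k f = begin
    ∑ xs (λ x → f x ⊗ k)  ≈⟨ ∑-cong xs (λ x → *-comm (f x) k) ⟩
    ∑ xs (λ x → k ⊗ f x)  ≈⟨ ∑-*ˡ xs k f ⟩
    k ⊗ ∑ xs f            ≈⟨ *-comm k _ ⟩
    ∑ xs f ⊗ k            ∎

  ∑-swap : (xs : List A) (ys : List B) (f : A → B → Carrier) →
           ∑ xs (λ x → ∑ ys (f x)) ≈ ∑ ys (λ y → ∑ xs (λ x → f x y))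
  ∑-swap []       ys f = ≈-sym (∑-zero ys (λ _ → ≈-refl))
  ∑-swap (x ∷ xs) ys f = ≈-trans (+-congˡ (∑-swap xs ys f)) (≈-sym (∑-+ ys (f x) _))

-- Orders are counted in ℕ, where subtraction-free estimates and cancellation are convenient; `ι`
-- later carries the resulting inequalities to the field.
module ℕ∑ where
  open ListSum ℕ.+-*-commutativeSemiring public

  ∑-mono-∈ : (xs : List A) {f g : A → ℕ} → (∀ {x} → x ∈ xs → f x ≤ g x) → ∑ xs f ≤ ∑ xs g
  ∑-mono-∈ []       le = z≤n
  ∑-mono-∈ (x ∷ xs) le = ℕ.+-mono-≤ (le (here refl)) (∑-mono-∈ xs (le ∘ there))

  ∑-mono : (xs : List A) {f g : A → ℕ} → (∀ x → f x ≤ g x) → ∑ xs f ≤ ∑ xs g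
  ∑-mono xs le = ∑-mono-∈ xs (λ {x} _ → le x)

  ∑-const : (xs : List A) (k : ℕ) → ∑ xs (λ _ → k) ≡ length xs * k
  ∑-const []       k = refl
  ∑-const (x ∷ xs) k = cong (k +_) (∑-const xs k)

-- Truth values as numbers

⟦_⟧ : Bool → ℕ
⟦ true  ⟧ = 1
⟦ false ⟧ = 0

⟦⟧≤1 : ∀ b → ⟦ b ⟧ ≤ 1
⟦⟧≤1 true  = s≤s z≤n
⟦⟧≤1 false = z≤n

<ᵇ-true : ∀ {i j} → i < j → (i <ᵇ j) ≡ true
<ᵇ-true {zero}  {suc j} _       = refl
<ᵇ-true {suc i} {suc j} (s≤s p) = <ᵇ-true p

<ᵇ-true⁻¹ : ∀ i j → (i <ᵇ j) ≡ true → i < j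
<ᵇ-true⁻¹ zero    (suc j) _ = s≤s z≤n
<ᵇ-true⁻¹ (suc i) (suc j) e = s≤s (<ᵇ-true⁻¹ i j e)

⟦<ᵇ⟧-antitone : ∀ {i i′} j → i′ ≤ i → ⟦ i <ᵇ j ⟧ ≤ ⟦ i′ <ᵇ j ⟧
⟦<ᵇ⟧-antitone {i} {i′} j i′≤i with i <ᵇ j in eq
... | false = z≤n
... | true rewrite <ᵇ-true (ℕ.≤-<-trans i′≤i (<ᵇ-true⁻¹ i j eq)) = ℕ.≤-refl

-- Linear orders as lists, generated by insertion

module Orders (_≟_ : DecidableEquality A) where
  open ℕ∑

  insertions : A → List A → List (List A)
  insertions x []      = (x ∷ []) ∷ []
  insertions x (y ∷ l) = (x ∷ y ∷ l) ∷ map (y ∷_) (insertions x l)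

  -- The head is the element inserted last. Grouping orders by the list into which it is inserted
  -- fixes the relative order of all the others.
  orders : List A → List (List A)
  orders []       = [] ∷ []
  orders (x ∷ xs) = concatMap (insertions x) (orders xs)

  ∑-insertions-∷ : ∀ x y l (f : List A → ℕ) →
    ∑ (insertions x (y ∷ l)) f ≡ f (x ∷ y ∷ l) + ∑ (insertions x l) (f ∘ (y ∷_))
  ∑-insertions-∷ x y l f = cong (f (x ∷ y ∷ l) +_) (∑-map (y ∷_) (insertions x l) f)

  ∑-orders-∷ : ∀ x xs (f : List A → ℕ) →
    ∑ (orders (x ∷ xs)) f ≡ ∑ (orders xs) (λ l → ∑ (insertions x l) f)
  ∑-orders-∷ x xs f = ∑-concatMap (insertions x) (orders xs) f

  -- Induction on `l`. In `z ∷ l` both elements land in front of `z`, or exactly one does, or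
  -- neither does. The first two groups are symmetric in `x` and `y`; the third is the induction
  -- hypothesis.
  insertions-swap : ∀ x y l (f : List A → ℕ) →
    ∑ (insertions x l) (λ l′ → ∑ (insertions y l′) f) ≡
    ∑ (insertions y l) (λ l′ → ∑ (insertions x l′) f)
  insertions-swap x y [] f =
    solve 2 (λ a b → (a :+ (b :+ con 0)) :+ con 0 := (b :+ (a :+ con 0)) :+ con 0) refl
      (f (y ∷ x ∷ [])) (f (x ∷ y ∷ []))
  insertions-swap x y (z ∷ l) f = begin
    ∑ (insertions x (z ∷ l)) (λ l′ → ∑ (insertions y l′) f)
      ≡⟨ expand x y ⟩
    (f (y ∷ x ∷ z ∷ l) + (f (x ∷ y ∷ z ∷ l) + ∑ (insertions y l) (λ l′ → f (x ∷ z ∷ l′)))) +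
    (∑ (insertions x l) (λ l′ → f (y ∷ z ∷ l′)) +
     ∑ (insertions x l) (λ l′ → ∑ (insertions y l′) (f ∘ (z ∷_))))
      ≡⟨ cong (λ s → (f (y ∷ x ∷ z ∷ l) + (f (x ∷ y ∷ z ∷ l) + ∑ (insertions y l) (λ l′ → f (x ∷ z ∷ l′)))) +
                     (∑ (insertions x l) (λ l′ → f (y ∷ z ∷ l′)) + s))
              (insertions-swap x y l (f ∘ (z ∷_))) ⟩
    (f (y ∷ x ∷ z ∷ l) + (f (x ∷ y ∷ z ∷ l) + ∑ (insertions y l) (λ l′ → f (x ∷ z ∷ l′)))) +
    (∑ (insertions x l) (λ l′ → f (y ∷ z ∷ l′)) +
     ∑ (insertions y l) (λ l′ → ∑ (insertions x l′) (f ∘ (z ∷_))))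
      ≡⟨ solve 5 (λ a b c d e → (a :+ (b :+ c)) :+ (d :+ e) := (b :+ (a :+ d)) :+ (c :+ e)) refl
           (f (y ∷ x ∷ z ∷ l)) (f (x ∷ y ∷ z ∷ l)) _ _ _ ⟩
    (f (x ∷ y ∷ z ∷ l) + (f (y ∷ x ∷ z ∷ l) + ∑ (insertions x l) (λ l′ → f (y ∷ z ∷ l′)))) +
    (∑ (insertions y l) (λ l′ → f (x ∷ z ∷ l′)) +
     ∑ (insertions y l) (λ l′ → ∑ (insertions x l′) (f ∘ (z ∷_))))
      ≡⟨ expand y x ⟨
    ∑ (insertions y (z ∷ l)) (λ l′ → ∑ (insertions x l′) f) ∎
    where
    open ≡.≡-Reasoning
    expand : ∀ x y → ∑ (insertions x (z ∷ l)) (λ l′ → ∑ (insertions y l′) f) ≡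
      (f (y ∷ x ∷ z ∷ l) + (f (x ∷ y ∷ z ∷ l) + ∑ (insertions y l) (λ l′ → f (x ∷ z ∷ l′)))) +
      (∑ (insertions x l) (λ l′ → f (y ∷ z ∷ l′)) +
       ∑ (insertions x l) (λ l′ → ∑ (insertions y l′) (f ∘ (z ∷_))))
    expand x y = begin
      ∑ (insertions x (z ∷ l)) (λ l′ → ∑ (insertions y l′) f)
        ≡⟨ ∑-insertions-∷ x z l _ ⟩
      ∑ (insertions y (x ∷ z ∷ l)) f + ∑ (insertions x l) (λ l′ → ∑ (insertions y (z ∷ l′)) f)
        ≡⟨ cong₂ _+_
             (≡.trans (∑-insertions-∷ y x (z ∷ l) f)
               (cong (f (y ∷ x ∷ z ∷ l) +_) (∑-insertions-∷ y z l _)))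
             (≡.trans (∑-cong (insertions x l) (λ l′ → ∑-insertions-∷ y z l′ f))
               (∑-+ (insertions x l) _ _)) ⟩
      _ ∎

  -- Thanks to this, any chosen element can be taken as the head, hence as the one inserted last. A
  -- transposition of the first two elements is `insertions-swap`.
  ∑-orders-↭ : ∀ {xs ys} → xs ↭ ys → (f : List A → ℕ) → ∑ (orders xs) f ≡ ∑ (orders ys) f
  ∑-orders-↭ Permutation.refl f = refl
  ∑-orders-↭ (prep {xs} {ys} x p) f =
    ≡.trans (∑-orders-∷ x xs f)
      (≡.trans (∑-orders-↭ p _) (≡.sym (∑-orders-∷ x ys f)))
  ∑-orders-↭ (swap {xs} {ys} x y p) f = begin
    ∑ (orders (x ∷ y ∷ xs)) f
      ≡⟨ unfold x y xs ⟩
    ∑ (orders xs) (λ l → ∑ (insertions y l) (λ l′ → ∑ (insertions x l′) f))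
      ≡⟨ ∑-cong (orders xs) (λ l → insertions-swap y x l f) ⟩
    ∑ (orders xs) (λ l → ∑ (insertions x l) (λ l′ → ∑ (insertions y l′) f))
      ≡⟨ ∑-orders-↭ p _ ⟩
    ∑ (orders ys) (λ l → ∑ (insertions x l) (λ l′ → ∑ (insertions y l′) f))
      ≡⟨ unfold y x ys ⟨
    ∑ (orders (y ∷ x ∷ ys)) f ∎
    where
    open ≡.≡-Reasoning
    unfold : ∀ x y xs → ∑ (orders (x ∷ y ∷ xs)) f ≡
             ∑ (orders xs) (λ l → ∑ (insertions y l) (λ l′ → ∑ (insertions x l′) f))
    unfold x y xs = ≡.trans (∑-orders-∷ x (y ∷ xs) f) (∑-orders-∷ y xs _)
  ∑-orders-↭ (Permutation.trans p q) f = ≡.trans (∑-orders-↭ p f) (∑-orders-↭ q f)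

  -- Needed to know that the sample space is nonempty: always inserting at the front gives back
  -- `xs`.
  ∈-orders : ∀ xs → xs ∈ orders xs
  ∈-orders []       = here refl
  ∈-orders (x ∷ xs) = ∈-concatMap⁺ (insertions x) (lose (∈-orders xs) (front xs))
    where
    front : ∀ l → x ∷ l ∈ insertions x l
    front []      = here refl
    front (_ ∷ _) = here refl

  length-insertions : ∀ x l → length (insertions x l) ≡ suc (length l)
  length-insertions x []      = refl
  length-insertions x (y ∷ l) =
    cong suc (≡.trans (List.length-map (y ∷_) (insertions x l)) (length-insertions x l))

  ∈-insertions⇒length : ∀ x l {l′} → l′ ∈ insertions x l → length l′ ≡ suc (length l)
  ∈-insertions⇒length x []      (here refl) = refl
  ∈-insertions⇒length x (y ∷ l) (here refl) = refl
  ∈-insertions⇒length x (y ∷ l) (there p) with ∈-map⁻ (y ∷_) p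
  ... | _ , q , refl = cong suc (∈-insertions⇒length x l q)

  ∈-orders⇒length : ∀ xs {l} → l ∈ orders xs → length l ≡ length xs
  ∈-orders⇒length []       (here refl) = refl
  ∈-orders⇒length (x ∷ xs) p with find (∈-concatMap⁻ (insertions x) {xs = orders xs} p)
  ... | l , l∈ , l′∈ = ≡.trans (∈-insertions⇒length x l l′∈) (cong suc (∈-orders⇒length xs l∈))

  -- Positions in a list, and moving an element forward

  -- Position of the first occurrence, and the length of the list if there is none.
  index : List A → A → ℕ
  index []      i = 0
  index (x ∷ l) i with x ≟ i
  ... | yes _ = 0
  ... | no  _ = suc (index l i)

  before : List A → A → A → Bool
  before l i j = index l i <ᵇ index l j

  index-≡ : ∀ {x i} l → x ≡ i → index (x ∷ l) i ≡ 0
  index-≡ {x} {i} l x≡i with x ≟ i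
  ... | yes _  = refl
  ... | no x≢i = ⊥-elim (x≢i x≡i)

  index-≢ : ∀ {x i} l → x ≢ i → index (x ∷ l) i ≡ suc (index l i)
  index-≢ {x} {i} l x≢i with x ≟ i
  ... | yes x≡i = ⊥-elim (x≢i x≡i)
  ... | no _    = refl

  index-∷-≤ : ∀ x l i → index (x ∷ l) i ≤ suc (index l i)
  index-∷-≤ x l i with x ≟ i
  ... | yes _ = z≤n
  ... | no  _ = ℕ.≤-refl

  -- The property of moving o towards the front that is needed: constraints "i before j" survive
  -- unless j is o.
  Advances : A → List A → List A → Set _
  Advances o l l′ = ∀ i j → j ≢ o → index l i < index l j → index l′ i < index l′ j

  advances-∷ : ∀ {o l l′} y → Advances o l l′ → Advances o (y ∷ l) (y ∷ l′)
  advances-∷ y adv i j j≢o lt with y ≟ i | y ≟ j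
  ... | yes _ | no _ = s≤s z≤n
  ... | no _  | no _ = s≤s (adv i j j≢o (ℕ.≤-pred lt))

  -- An inserted `o` shifts other elements but never changes which of two of them comes first.
  insertions-reflect : ∀ o l {l′} → l′ ∈ insertions o l → ∀ i j → i ≢ o → j ≢ o →
                       index l′ i < index l′ j → index l i < index l j
  insertions-reflect o [] (here refl) i j i≢o j≢o lt
    rewrite index-≢ [] (i≢o ∘ ≡.sym) | index-≢ [] (j≢o ∘ ≡.sym) = ℕ.≤-pred lt
  insertions-reflect o (y ∷ l) (here refl) i j i≢o j≢o lt
    rewrite index-≢ (y ∷ l) (i≢o ∘ ≡.sym) | index-≢ (y ∷ l) (j≢o ∘ ≡.sym) = ℕ.≤-pred lt
  insertions-reflect o (y ∷ l) (there p) i j i≢o j≢o lt with ∈-map⁻ (y ∷_) p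
  ... | l″ , q , refl with y ≟ i | y ≟ j
  ... | yes _ | no _ = s≤s z≤n
  ... | no _  | no _ = s≤s (insertions-reflect o l q i j i≢o j≢o (ℕ.≤-pred lt))

  -- At the very front `o` precedes everything else, and comparisons between other elements are
  -- those of the list without the inserted `o`.
  advances-front : ∀ o y l {l′} → l′ ∈ insertions o l → Advances o (y ∷ l′) (o ∷ y ∷ l)
  advances-front o y l {l′} l′∈ i j j≢o lt with o ≟ i
  ... | yes _  rewrite index-≢ (y ∷ l) (j≢o ∘ ≡.sym) = s≤s z≤n
  ... | no o≢i rewrite index-≢ (y ∷ l) (j≢o ∘ ≡.sym) =
    s≤s (insertions-reflect o (y ∷ l) (there (∈-map⁺ (y ∷_) l′∈)) i j (o≢i ∘ ≡.sym) j≢o lt)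

  -- Insertions of `o` in front of `j`

  module _ (o j : A) (o≢j : o ≢ j) where

    -- The position of `j` grows by one only if `o` lands in front of it.
    index-insertions : ∀ g {l} → l ∈ insertions o g → index l j ≤ index g j + ⟦ before l o j ⟧
    index-insertions [] (here refl)
      rewrite index-≢ [] o≢j | index-≡ {o} [] refl = ℕ.≤-refl
    index-insertions (y ∷ g) (here refl)
      rewrite index-≢ (y ∷ g) o≢j | index-≡ {o} (y ∷ g) refl = ℕ.≤-reflexive (ℕ.+-comm 1 _)
    index-insertions (y ∷ g) (there p) with ∈-map⁻ (y ∷_) p
    ... | l , q , refl with y ≟ j
    ... | yes _ = z≤n
    -- `g` may already contain `o`, so `y` may be `o` itself. Its position in `y ∷ l` is then 0,
    -- which can only help `o` to precede `j`.
    ... | no _  = s≤s (ℕ.≤-trans (index-insertions g q)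
            (ℕ.+-monoʳ-≤ (index g j) (⟦<ᵇ⟧-antitone (suc (index l j)) (index-∷-≤ y l o))))

    -- The weights of the successive insertions of o decrease, and c is the weight of the last one
    -- in front of j. So the insertions in front of j have weight at least c, the t others at most c.
    threshold : ∀ g (w : List A → ℕ) → (∀ {l l′} → Advances o l l′ → w l ≤ w l′) →
      ∃ λ c → (∃ λ l → l ∈ insertions o g × c ≡ w l) ×
      ∃ λ t → index g j + t ≡ length g ×
      suc (index g j) * c ≤ ∑ (insertions o g) (λ l → w l * ⟦ before l o j ⟧) ×
      ∑ (insertions o g) w ≤ ∑ (insertions o g) (λ l → w l * ⟦ before l o j ⟧) + t * c
    -- An absent `j` has the length of the list as its position, so the single insertion counts as
    -- lying in front of `j`.
    threshold [] w mono rewrite index-≢ [] o≢j | index-≡ {o} [] refl =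
      w (o ∷ []) , (_ , here refl , refl) , 0 , refl ,
      ℕ.+-monoˡ-≤ 0 (ℕ.≤-reflexive (≡.sym (ℕ.*-identityʳ _))) ,
      ℕ.≤-reflexive (≡.trans (cong (_+ 0) (≡.sym (ℕ.*-identityʳ _))) (≡.sym (ℕ.+-identityʳ _)))
    threshold (y ∷ g) w mono
      rewrite ∑-insertions-∷ o y g w
            | ∑-insertions-∷ o y g (λ l → w l * ⟦ before l o j ⟧)
            | index-≢ (y ∷ g) o≢j | index-≡ {o} (y ∷ g) refl
            | ℕ.*-identityʳ (w (o ∷ y ∷ g))
      with y ≟ j
    -- With `j` at the head, only the insertion at the very front precedes it. All the
    -- `suc (length g)` others arise from that one by moving `o` back, so they weigh at most `c`.
    ... | yes _ =
      c , (_ , here refl , refl) , suc (length g) , refl ,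
      ℕ.+-monoʳ-≤ c z≤n ,
      ℕ.+-mono-≤ (ℕ.m≤m+n c _) rest
      where
      c = w (o ∷ y ∷ g)
      rest : ∑ (insertions o g) (w ∘ (y ∷_)) ≤ suc (length g) * c
      rest = begin
        ∑ (insertions o g) (w ∘ (y ∷_)) ≤⟨ ∑-mono-∈ (insertions o g) (mono ∘ advances-front o y g) ⟩
        ∑ (insertions o g) (λ _ → c)    ≡⟨ ∑-const (insertions o g) c ⟩
        length (insertions o g) * c     ≡⟨ cong (_* c) (length-insertions o g) ⟩
        suc (length g) * c              ∎
        where open ℕ.≤-Reasoning
    ... | no y≢j with threshold g (w ∘ (y ∷_)) (mono ∘ advances-∷ y)
    -- The threshold stays where it was, and the insertion in front of `y` is one more in front of
    -- `j`. The witness `l` is what allows its weight to be compared with `c`.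
    ... | c , (l , l∈ , refl) , t , eq , lower , upper =
      c , (_ , there (∈-map⁺ (y ∷_) l∈) , refl) , t , cong suc eq ,
      ℕ.+-mono-≤ (mono (advances-front o y g l∈)) (ℕ.≤-trans lower grow) ,
      (begin
        w₀ + ∑ (insertions o g) (w ∘ (y ∷_))  ≤⟨ ℕ.+-monoʳ-≤ w₀ (ℕ.≤-trans upper (ℕ.+-monoˡ-≤ (t * c) grow)) ⟩
        w₀ + (_ + t * c)                      ≡⟨ ℕ.+-assoc w₀ _ _ ⟨
        (w₀ + _) + t * c                      ∎)
      where
      open ℕ.≤-Reasoning
      w₀ = w (o ∷ y ∷ g)
      grow : ∑ (insertions o g) (λ l → w (y ∷ l) * ⟦ before l o j ⟧) ≤
             ∑ (insertions o g) (λ l → w (y ∷ l) * ⟦ index (y ∷ l) o <ᵇ suc (index l j) ⟧)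
      grow = ∑-mono (insertions o g) (λ l → ℕ.*-monoʳ-≤ (w (y ∷ l))
        (⟦<ᵇ⟧-antitone (suc (index l j)) (index-∷-≤ y l o)))

    -- Let `s` insertions lie in front of `j`, with weight `X`, and let `Y` be the total weight.
    -- From `s * c ≤ X` and `Y ≤ X + t * c` follows `s * Y ≤ (s + t) * X`, which is the bound (r +
    -- 1) / n on the conditional probability, as `s + t` is `suc (length g)`. One more `X` is due
    -- because `j` moves up by one whenever `o` precedes it.
    insertion-bound : ∀ g (w : List A → ℕ) → (∀ {l l′} → Advances o l l′ → w l ≤ w l′) →
      ∑ (insertions o g) (λ l → w l * suc (index l j)) ≤
      suc (suc (length g)) * ∑ (insertions o g) (λ l → w l * ⟦ before l o j ⟧)
    insertion-bound g w mono with threshold g w mono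
    ... | c , _ , t , eq , lower , upper = begin
      ∑ (insertions o g) (λ l → w l * suc (index l j))
        ≤⟨ ∑-mono-∈ (insertions o g) (λ {l} l∈ → ℕ.*-monoʳ-≤ (w l) (s≤s (index-insertions g l∈))) ⟩
      ∑ (insertions o g) (λ l → w l * (s + ⟦ before l o j ⟧))
        ≡⟨ ∑-cong (insertions o g) (λ l → ℕ.*-distribˡ-+ (w l) s _) ⟩
      ∑ (insertions o g) (λ l → w l * s + w l * ⟦ before l o j ⟧)
        ≡⟨ ∑-+ (insertions o g) _ _ ⟩
      ∑ (insertions o g) (λ l → w l * s) + X
        ≡⟨ cong (_+ X) (∑-*ʳ (insertions o g) s w) ⟩
      Y * s + X
        ≤⟨ ℕ.+-monoˡ-≤ X (ℕ.*-monoˡ-≤ s upper) ⟩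
      (X + t * c) * s + X
        ≡⟨ solve 4 (λ x t c s → (x :+ t :* c) :* s :+ x := (s :* x :+ x) :+ t :* (s :* c)) refl X t c s ⟩
      (s * X + X) + t * (s * c)
        ≤⟨ ℕ.+-monoʳ-≤ (s * X + X) (ℕ.*-monoʳ-≤ t lower) ⟩
      (s * X + X) + t * X
        ≡⟨ solve 3 (λ x t i → ((con 1 :+ i) :* x :+ x) :+ t :* x := (con 2 :+ (i :+ t)) :* x) refl X t (index g j) ⟩
      (2 + (index g j + t)) * X
        ≡⟨ cong (λ k → suc (suc k) * X) eq ⟩
      suc (suc (length g)) * X ∎
      where
      open ℕ.≤-Reasoning
      s = suc (index g j)
      X = ∑ (insertions o g) (λ l → w l * ⟦ before l o j ⟧)
      Y = ∑ (insertions o g) w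

    -- With `o` permuted to the head, the bound for one round of insertions can be summed over all
    -- orders of the rest.
    orders-bound : ∀ xs (w : List A → ℕ) → o ∈ xs → (∀ {l l′} → Advances o l l′ → w l ≤ w l′) →
      ∑ (orders xs) (λ l → w l * suc (index l j)) ≤
      suc (length xs) * ∑ (orders xs) (λ l → w l * ⟦ before l o j ⟧)
    orders-bound xs w o∈xs mono with ∈-∃++ o∈xs
    ... | ys , zs , refl = begin
      ∑ (orders xs) (λ l → w l * suc (index l j))
        ≡⟨ ∑-orders-↭ xs↭ _ ⟩
      ∑ (orders (o ∷ rest)) (λ l → w l * suc (index l j))
        ≡⟨ ∑-orders-∷ o rest _ ⟩
      ∑ (orders rest) (λ g → ∑ (insertions o g) (λ l → w l * suc (index l j)))
        ≤⟨ ∑-mono-∈ (orders rest) (λ {g} g∈ → subst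
             (λ k → ∑ (insertions o g) (λ l → w l * suc (index l j)) ≤
                    suc k * ∑ (insertions o g) (λ l → w l * ⟦ before l o j ⟧))
             (≡.trans (cong suc (∈-orders⇒length rest g∈)) (≡.sym (↭-length xs↭)))
             (insertion-bound g w mono)) ⟩
      ∑ (orders rest) (λ g → suc (length xs) * ∑ (insertions o g) (λ l → w l * ⟦ before l o j ⟧))
        ≡⟨ ∑-*ˡ (orders rest) (suc (length xs)) _ ⟩
      suc (length xs) * ∑ (orders rest) (λ g → ∑ (insertions o g) (λ l → w l * ⟦ before l o j ⟧))
        ≡⟨ cong (suc (length xs) *_) (∑-orders-∷ o rest _) ⟨
      suc (length xs) * ∑ (orders (o ∷ rest)) (λ l → w l * ⟦ before l o j ⟧)
        ≡⟨ cong (suc (length xs) *_) (∑-orders-↭ xs↭ _) ⟨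
      suc (length xs) * ∑ (orders xs) (λ l → w l * ⟦ before l o j ⟧) ∎
      where
      open ℕ.≤-Reasoning
      rest = ys ++ zs
      xs↭ = shift o ys zs

  -- The average number of predecessors

  ∑-≟≤1 : ∀ {xs} → Unique xs → ∀ b → ∑ xs (λ x → ⟦ does (b ≟ x) ⟧) ≤ 1
  ∑-≟≤1 []       b = z≤n
  ∑-≟≤1 {x ∷ xs} (x∉xs ∷ u) b with b ≟ x
  ... | no _     = ∑-≟≤1 u b
  ... | yes refl = s≤s (ℕ.≤-reflexive (≡.trans
          (∑-cong-∈ xs (λ x∈ → cong ⟦_⟧ (Dec.dec-false (b ≟ _) (All.lookup x∉xs x∈))))
          (∑-zero xs (λ _ → refl))))

  predecessors : List A → List A → A → ℕ
  predecessors xs l j = ∑ xs (λ i → ⟦ before l i j ⟧)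

  -- Each entry of `l` in front of `j` accounts for at most one element of the duplicate-free `xs`.
  -- It may account for none, since `l` is arbitrary here.
  predecessors≤index : ∀ {xs} → Unique xs → ∀ l j → predecessors xs l j ≤ index l j
  predecessors≤index {xs} u []      j = ℕ.≤-reflexive (∑-zero xs (λ _ → refl))
  predecessors≤index {xs} u (x ∷ l) j with x ≟ j
  ... | yes _ = ℕ.≤-reflexive (∑-zero xs (λ i → cong ⟦_⟧ (<ᵇ0 (index (x ∷ l) i))))
    where
    <ᵇ0 : ∀ k → (k <ᵇ 0) ≡ false
    <ᵇ0 zero    = refl
    <ᵇ0 (suc k) = refl
  ... | no _ = begin
    ∑ xs (λ i → ⟦ index (x ∷ l) i <ᵇ suc (index l j) ⟧)
      ≤⟨ ∑-mono xs split ⟩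
    ∑ xs (λ i → ⟦ does (x ≟ i) ⟧ + ⟦ before l i j ⟧)
      ≡⟨ ∑-+ xs _ _ ⟩
    ∑ xs (λ i → ⟦ does (x ≟ i) ⟧) + predecessors xs l j
      ≤⟨ ℕ.+-mono-≤ (∑-≟≤1 u x) (predecessors≤index u l j) ⟩
    suc (index l j) ∎
    where
    open ℕ.≤-Reasoning
    split : ∀ i → ⟦ index (x ∷ l) i <ᵇ suc (index l j) ⟧ ≤ ⟦ does (x ≟ i) ⟧ + ⟦ before l i j ⟧
    split i with x ≟ i
    ... | yes _ = s≤s z≤n
    ... | no _  = ℕ.≤-refl

  -- Double counting of `D`, the weighted sum of the positions of `j` counted from one. Summing the
  -- bound for each `o` over `xs` gives `n * D ≤ suc n * W₁ + suc d * D`, so `k * D ≤ suc n * W₁`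
  -- for `k = n ∸ suc d`. The assumption on `n` yields `suc n ≤ k + k`, hence `D ≤ 2 * W₁`, while
  -- `W + W₁ ≤ D`.
  average-predecessors : ∀ {xs} d → Unique xs → 2 * d + 3 ≤ length xs →
    ∀ j (w : List A → ℕ) (fixed : List A) → length fixed ≤ suc d → j ∈ fixed →
    (∀ {o} → ¬ (o ∈ fixed) → ∀ {l l′} → Advances o l l′ → w l ≤ w l′) →
    ∑ (orders xs) w ≤ ∑ (orders xs) (λ l → w l * predecessors xs l j)
  average-predecessors {xs} d u 2d+3≤n j w fixed ∣fixed∣≤ j∈fixed mono =
    ℕ.+-cancelʳ-≤ W₁ W W₁ (ℕ.≤-trans W+W₁≤D (ℕ.≤-trans D≤2W₁ (ℕ.≤-reflexive (cong (W₁ +_) (ℕ.+-identityʳ W₁)))))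
    where
    open ℕ.≤-Reasoning
    open import Data.List.Membership.DecPropositional _≟_ using (_∈?_)
    n k W W₁ D : ℕ
    n  = length xs
    k  = n ∸ suc d
    W  = ∑ (orders xs) w
    W₁ = ∑ (orders xs) (λ l → w l * predecessors xs l j)
    D  = ∑ (orders xs) (λ l → w l * suc (index l j))

    C M : A → ℕ
    C o = ∑ (orders xs) (λ l → w l * ⟦ before l o j ⟧)
    -- The multiplicity of `o` in `fixed`. It allows one inequality for all `o`, and its total over
    -- `xs` is at most `suc d` even if `fixed` has repetitions.
    M o = ∑ fixed (λ b → ⟦ does (b ≟ o) ⟧)

    W+W₁≤D : W + W₁ ≤ D
    W+W₁≤D = begin
      W + W₁
        ≡⟨ ∑-+ (orders xs) _ _ ⟨
      ∑ (orders xs) (λ l → w l + w l * predecessors xs l j)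
        ≡⟨ ∑-cong (orders xs) (λ l → ≡.sym (ℕ.*-suc (w l) _)) ⟩
      ∑ (orders xs) (λ l → w l * suc (predecessors xs l j))
        ≤⟨ ∑-mono (orders xs) (λ l → ℕ.*-monoʳ-≤ (w l) (s≤s (predecessors≤index u l j))) ⟩
      D ∎

    ∈⇒1≤ : ∀ {o} {bs : List A} → o ∈ bs → 1 ≤ ∑ bs (λ b → ⟦ does (b ≟ o) ⟧)
    ∈⇒1≤ {o} (here refl) rewrite Dec.dec-true (o ≟ o) refl = s≤s z≤n
    ∈⇒1≤ (there p) = ℕ.≤-trans (∈⇒1≤ p) (ℕ.m≤n+m _ _)

    bound : ∀ {o} → o ∈ xs → D ≤ suc n * C o + M o * D
    bound {o} o∈ with o ∈? fixed
    -- Nothing is known about moving such an `o`; the trivial bound `D ≤ M o * D` is paid for by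
    -- `∑M`.
    ... | yes o∈fixed = ℕ.≤-trans
            (ℕ.≤-trans (ℕ.≤-reflexive (≡.sym (ℕ.*-identityˡ D))) (ℕ.*-monoˡ-≤ D (∈⇒1≤ o∈fixed)))
            (ℕ.m≤n+m _ _)
    ... | no o∉fixed = ℕ.≤-trans
            (orders-bound o j (λ { refl → o∉fixed j∈fixed }) xs w o∈ (mono o∉fixed)) (ℕ.m≤m+n _ _)

    ∑C : ∑ xs C ≡ W₁
    ∑C = ≡.trans (∑-swap xs (orders xs) (λ o l → w l * ⟦ before l o j ⟧))
                 (∑-cong (orders xs) (λ l → ∑-*ˡ xs (w l) (λ o → ⟦ before l o j ⟧)))

    ∑M : ∑ xs M ≤ suc d
    ∑M = begin
      ∑ xs M                                              ≡⟨ ∑-swap xs fixed (λ o b → ⟦ does (b ≟ o) ⟧) ⟩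
      ∑ fixed (λ b → ∑ xs (λ o → ⟦ does (b ≟ o) ⟧))  ≤⟨ ∑-mono fixed (∑-≟≤1 u) ⟩
      ∑ fixed (λ _ → 1)                                   ≡⟨ ∑-const fixed 1 ⟩
      length fixed * 1                                    ≡⟨ ℕ.*-identityʳ _ ⟩
      length fixed                                        ≤⟨ ∣fixed∣≤ ⟩
      suc d                                               ∎

    n≡ : k + suc d ≡ n
    n≡ = ℕ.m∸n+n≡m (ℕ.≤-trans
      (ℕ.≤-trans (ℕ.m≤m+n (suc d) (2 + d))
        (ℕ.≤-reflexive (solve 1 (λ d → (con 1 :+ d) :+ (con 2 :+ d) := con 2 :* d :+ con 3) refl d)))
      2d+3≤n)

    d+2≤k : 2 + d ≤ k
    d+2≤k = ℕ.+-cancelʳ-≤ (suc d) (2 + d) k (begin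
      (2 + d) + suc d  ≡⟨ solve 1 (λ d → (con 2 :+ d) :+ (con 1 :+ d) := con 2 :* d :+ con 3) refl d ⟩
      2 * d + 3        ≤⟨ 2d+3≤n ⟩
      n                ≡⟨ n≡ ⟨
      k + suc d        ∎)

    kD≤ : k * D ≤ k * (2 * W₁)
    kD≤ = ℕ.+-cancelʳ-≤ (suc d * D) (k * D) (k * (2 * W₁)) (begin
      k * D + suc d * D                         ≡⟨ ℕ.*-distribʳ-+ D k (suc d) ⟨
      (k + suc d) * D                           ≡⟨ cong (_* D) n≡ ⟩
      n * D                                     ≡⟨ ∑-const xs D ⟨
      ∑ xs (λ _ → D)                            ≤⟨ ∑-mono-∈ xs bound ⟩
      ∑ xs (λ o → suc n * C o + M o * D)        ≡⟨ ∑-+ xs _ _ ⟩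
      ∑ xs (λ o → suc n * C o) + ∑ xs (λ o → M o * D)
        ≡⟨ cong₂ _+_ (≡.trans (∑-*ˡ xs (suc n) C) (cong (suc n *_) ∑C)) (∑-*ʳ xs D M) ⟩
      suc n * W₁ + ∑ xs M * D                   ≤⟨ ℕ.+-mono-≤ (ℕ.*-monoˡ-≤ W₁ n+1≤2k) (ℕ.*-monoˡ-≤ D ∑M) ⟩
      (k + k) * W₁ + suc d * D
        ≡⟨ cong (_+ suc d * D) (solve 2 (λ k x → (k :+ k) :* x := k :* (con 2 :* x)) refl k W₁) ⟩
      k * (2 * W₁) + suc d * D                  ∎)
      where
      n+1≤2k : suc n ≤ k + k
      n+1≤2k = begin
        suc n            ≡⟨ cong suc n≡ ⟨
        suc (k + suc d)  ≡⟨ ℕ.+-suc k (suc d) ⟨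
        k + (2 + d)      ≤⟨ ℕ.+-monoʳ-≤ k d+2≤k ⟩
        k + k            ∎

    D≤2W₁ : D ≤ 2 * W₁
    D≤2W₁ = ℕ.*-cancelˡ-≤ k {{>-nonZero (ℕ.≤-trans (s≤s z≤n) d+2≤k)}} kD≤

≟S-sym : ∀ {m} (s t : Subset m) → (s ≟S t) ≡ (t ≟S s)
≟S-sym s t = Dec.does-⇔ (mk⇔ ≡.sym ≡.sym) (Vec.≡-dec Bool._≟_ s t) (Vec.≡-dec Bool._≟_ t s)

-- Ordered fields and the embedding of ℕ

module OrderedFieldProperties {c ℓ} (F : OrderedField c ℓ) where
  open OrderedField F
    renaming (_+_ to _⊕_; _*_ to _⊗_; _≤_ to infix 4 _⊑_; refl to ≈-refl; sym to ≈-sym; trans to ≈-trans)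
  open IsTotalOrder isTotalOrder using (total; antisym; ≤-respˡ-≈; ≤-respʳ-≈)
    renaming (trans to ⊑-trans; refl to ⊑-refl; reflexive to ⊑-reflexive)
  open RingProperties ring using (-‿distribˡ-*; -‿distribʳ-*; -‿involutive)
  open ListSum commutativeSemiring public
  open import Relation.Binary.Reasoning.Setoid setoid

  +-nonneg : ∀ {x y} → 0# ⊑ x → 0# ⊑ y → 0# ⊑ x ⊕ y
  +-nonneg {x} {y} 0≤x 0≤y = ⊑-trans 0≤y (≤-respˡ-≈ (+-identityˡ y) (+-mono-≤ y 0≤x))

  ≤⇒0≤- : ∀ {x y} → x ⊑ y → 0# ⊑ y - x
  ≤⇒0≤- {x} x≤y = ≤-respˡ-≈ (-‿inverseʳ x) (+-mono-≤ (- x) x≤y)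

  square-nonneg : ∀ x → 0# ⊑ x ⊗ x
  square-nonneg x with total 0# x
  ... | inj₁ 0≤x = *-nonneg 0≤x 0≤x
  ... | inj₂ x≤0 = ≤-respʳ-≈
          (≈-trans (≈-sym (-‿distribˡ-* x (- x))) (≈-trans (-‿cong (≈-sym (-‿distribʳ-* x x))) (-‿involutive _)))
          (*-nonneg 0≤-x 0≤-x)
    where
    0≤-x : 0# ⊑ - x
    0≤-x = ≤-respʳ-≈ (+-identityˡ (- x)) (≤⇒0≤- x≤0)

  0≤1 : 0# ⊑ 1#
  0≤1 = ≤-respʳ-≈ (*-identityˡ 1#) (square-nonneg 1#)

  -1≤0 : - 1# ⊑ 0#
  -1≤0 = ≤-respˡ-≈ (+-identityˡ (- 1#)) (≤-respʳ-≈ (-‿inverseʳ 1#) (+-mono-≤ (- 1#) 0≤1))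

  0≰-1 : ¬ 0# ⊑ - 1#
  0≰-1 0≤-1 = 0≉1 (antisym 0≤1 (≤-respˡ-≈ (+-identityˡ 1#) (≤-respʳ-≈ (-‿inverseˡ 1#) (+-mono-≤ 1# 0≤-1))))

  ∑-nonneg-∈ : (xs : List A) {f : A → Carrier} → (∀ {x} → x ∈ xs → 0# ⊑ f x) → 0# ⊑ ∑ xs f
  ∑-nonneg-∈ []       0≤f = ⊑-refl
  ∑-nonneg-∈ (x ∷ xs) 0≤f = +-nonneg (0≤f (here refl)) (∑-nonneg-∈ xs (0≤f ∘ there))

  ∑-nonneg : (xs : List A) {f : A → Carrier} → (∀ x → 0# ⊑ f x) → 0# ⊑ ∑ xs f
  ∑-nonneg xs 0≤f = ∑-nonneg-∈ xs (λ {x} _ → 0≤f x)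

  ∑-const≤member : ∀ {xs : List A} {x k} → x ∈ xs → k ⊑ 0# → ∑ xs (λ _ → k) ⊑ k
  ∑-const≤member {xs = x ∷ xs} {k = k} x∈ k≤0 = ≤-respˡ-≈ (+-comm _ k) (≤-respʳ-≈ (+-identityˡ k) (+-mono-≤ k (nonpos xs)))
    where
    nonpos : ∀ xs → ∑ xs (λ _ → k) ⊑ 0#
    nonpos []       = ⊑-refl
    nonpos (_ ∷ xs) = ⊑-trans (+-mono-≤ _ k≤0) (≤-respˡ-≈ (≈-sym (+-identityˡ _)) (nonpos xs))

  ι : ℕ → Carrier
  ι zero    = 0#
  ι (suc k) = 1# ⊕ ι k

  ι-+ : ∀ k l → ι (k + l) ≈ ι k ⊕ ι l
  ι-+ zero    l = ≈-sym (+-identityˡ _)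
  ι-+ (suc k) l = ≈-trans (+-congˡ (ι-+ k l)) (≈-sym (+-assoc _ _ _))

  ι-nonneg : ∀ k → 0# ⊑ ι k
  ι-nonneg zero    = ⊑-refl
  ι-nonneg (suc k) = +-nonneg 0≤1 (ι-nonneg k)

  ι-mono : ∀ {k l} → k ≤ l → ι k ⊑ ι l
  ι-mono {l = l} z≤n               = ι-nonneg l
  ι-mono {suc k} {suc l} (s≤s k≤l) = ≤-respˡ-≈ (+-comm (ι k) 1#) (≤-respʳ-≈ (+-comm (ι l) 1#) (+-mono-≤ 1# (ι-mono k≤l)))

  ι-∑ : (xs : List A) (f : A → ℕ) → ι (ℕ∑.∑ xs f) ≈ ∑ xs (ι ∘ f)
  ι-∑ []       f = ≈-refl
  ι-∑ (x ∷ xs) f = ≈-trans (ι-+ (f x) _) (+-congˡ (ι-∑ xs f))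

  χ : Bool → Carrier
  χ b = if b then 1# else 0#

  χ-nonneg : ∀ b → 0# ⊑ χ b
  χ-nonneg true  = 0≤1
  χ-nonneg false = ⊑-refl

  χ≈ι : ∀ b → χ b ≈ ι ⟦ b ⟧
  χ≈ι true  = ≈-sym (+-identityʳ 1#)
  χ≈ι false = ≈-refl

  if≈χ : ∀ b x → (if b then x else 0#) ≈ χ b ⊗ x
  if≈χ true  x = ≈-sym (*-identityˡ x)
  if≈χ false x = ≈-sym (zeroˡ x)

  χ-*-ι : ∀ b k → χ b ⊗ ι k ≈ ι (⟦ b ⟧ * k)
  χ-*-ι true  k = ≈-trans (*-identityˡ (ι k)) (reflexive (cong ι (≡.sym (ℕ.+-identityʳ k))))
  χ-*-ι false k = zeroˡ (ι k)

-- Evaluation of multilinear polynomials at 0/1 points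

module Evaluation {c ℓ} (F : OrderedField c ℓ) (m : ℕ) where
  open OrderedField F
    renaming (_+_ to _⊕_; _*_ to _⊗_; _≤_ to infix 4 _⊑_; refl to ≈-refl; sym to ≈-sym; trans to ≈-trans)
  open OrderedFieldProperties F
  open Multilinear F m
  open RingProperties ring using (-‿distribʳ-*; -1*x≈-x)
  open CommutativeSemigroupProperties *-commutativeSemigroup using (interchange; x∙yz≈y∙xz)
  open import Relation.Binary.Reasoning.Setoid setoid

  ∑-δ : ∀ {k} (U : Subset k) (f : Subset k → Carrier) → ∑ (subsets k) (λ T → χ (T ≟S U) ⊗ f T) ≈ f U
  ∑-δ Vec.[]      f = ≈-trans (+-identityʳ _) (*-identityˡ _)
  ∑-δ {suc k} (b Vec.∷ U) f = begin
    ∑ (subsets (suc k)) (λ T → χ (T ≟S (b Vec.∷ U)) ⊗ f T)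
      ≈⟨ ∑-concatMap (λ s → (false Vec.∷ s) ∷ (true Vec.∷ s) ∷ []) (subsets k) _ ⟩
    ∑ (subsets k) (λ s → χ ((false Vec.∷ s) ≟S (b Vec.∷ U)) ⊗ f (false Vec.∷ s) ⊕
                         (χ ((true Vec.∷ s) ≟S (b Vec.∷ U)) ⊗ f (true Vec.∷ s) ⊕ 0#))
      ≈⟨ ∑-cong (subsets k) (one b) ⟩
    ∑ (subsets k) (λ s → χ (s ≟S U) ⊗ f (b Vec.∷ s))
      ≈⟨ ∑-δ U (f ∘ (b Vec.∷_)) ⟩
    f (b Vec.∷ U) ∎
    where
    one : ∀ b s → χ ((false Vec.∷ s) ≟S (b Vec.∷ U)) ⊗ f (false Vec.∷ s) ⊕
                  (χ ((true Vec.∷ s) ≟S (b Vec.∷ U)) ⊗ f (true Vec.∷ s) ⊕ 0#) ≈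
                  χ (s ≟S U) ⊗ f (b Vec.∷ s)
    one false s = ≈-trans (+-congˡ (≈-trans (+-identityʳ _) (zeroˡ _))) (+-identityʳ _)
    one true  s = ≈-trans (+-cong (zeroˡ _) (+-identityʳ _)) (+-identityˡ _)

  ∑-δ′ : ∀ {k} (U : Subset k) (f : Subset k → Carrier) → ∑ (subsets k) (λ T → χ (U ≟S T) ⊗ f T) ≈ f U
  ∑-δ′ {k} U f = ≈-trans
    (∑-cong (subsets k) (λ T → *-congʳ (reflexive (cong χ (≟S-sym U T)))))
    (∑-δ U f)

  -- x_T under the assignment which makes true exactly the variables in V.
  monomial : Subset m → Subset m → Carrier
  monomial V T = χ (does (T Subset.⊆? V))

  eval : Subset m → Poly → Carrier
  eval V p = ∑ (subsets m) (λ T → monomial V T ⊗ p T)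

  eval-cong : ∀ V {p q} → p ≈P q → eval V p ≈ eval V q
  eval-cong V p≈q = ∑-cong (subsets m) (λ T → *-congˡ (p≈q T))

  eval-+ : ∀ V p q → eval V (p +P q) ≈ eval V p ⊕ eval V q
  eval-+ V p q = ≈-trans (∑-cong (subsets m) (λ T → distribˡ _ (p T) (q T))) (∑-+ (subsets m) _ _)

  eval-neg : ∀ V p → eval V (-P p) ≈ - eval V p
  eval-neg V p = begin
    ∑ (subsets m) (λ T → monomial V T ⊗ - p T)
      ≈⟨ ∑-cong (subsets m) (λ T → ≈-trans (≈-sym (-‿distribʳ-* _ (p T))) (≈-sym (-1*x≈-x _))) ⟩
    ∑ (subsets m) (λ T → - 1# ⊗ (monomial V T ⊗ p T))
      ≈⟨ ∑-*ˡ (subsets m) (- 1#) _ ⟩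
    - 1# ⊗ eval V p
      ≈⟨ -1*x≈-x _ ⟩
    - eval V p ∎

  eval-δ : ∀ V U x → eval V (λ T → if T ≟S U then x else 0#) ≈ monomial V U ⊗ x
  eval-δ V U x = begin
    ∑ (subsets m) (λ T → monomial V T ⊗ (if T ≟S U then x else 0#))
      ≈⟨ ∑-cong (subsets m) (λ T → ≈-trans (*-congˡ (if≈χ (T ≟S U) x)) (x∙yz≈y∙xz _ _ x)) ⟩
    ∑ (subsets m) (λ T → χ (T ≟S U) ⊗ (monomial V T ⊗ x))
      ≈⟨ ∑-δ U _ ⟩
    monomial V U ⊗ x ∎

  eval-const : ∀ V x → eval V (const x) ≈ x
  eval-const V x = ≈-trans (eval-δ V ⊥ x)
    (≈-trans (*-congʳ (reflexive (cong χ (Dec.dec-true (⊥ Subset.⊆? V) Subset.⊥⊆)))) (*-identityˡ x))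

  eval-var : ∀ V v → eval V (var v) ≈ χ (Vec.lookup V v)
  eval-var V v = ≈-trans (eval-δ V ⁅ v ⁆ 1#) (≈-trans (*-identityʳ _) (reflexive (cong χ ⁅v⁆⊆?V)))
    where
    ⁅v⁆⊆?V : does (⁅ v ⁆ Subset.⊆? V) ≡ Vec.lookup V v
    ⁅v⁆⊆?V with Vec.lookup V v in eq
    ... | true = Dec.dec-true (⁅ v ⁆ Subset.⊆? V)
          (λ x∈ → subst (_∈ˢ V) (≡.sym (Subset.x∈⁅y⁆⇒x≡y v x∈)) (Vec.lookup⇒[]= v V eq))
    ... | false = Dec.dec-false (⁅ v ⁆ Subset.⊆? V)
          (λ ⊆V → Bool.not-¬ (Vec.[]=⇒lookup (⊆V (Subset.x∈⁅x⁆ v))) eq)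

  -- A union lies in `V` exactly when both parts do. This is why evaluation at 0/1 points is
  -- compatible with multilinearised products, in particular with squares.
  monomial-∪ : ∀ V A B → monomial V (A ∪ B) ≈ monomial V A ⊗ monomial V B
  monomial-∪ V A B with A Subset.⊆? V | B Subset.⊆? V
  ... | yes A⊆ | yes B⊆ = ≈-trans
        (reflexive (cong χ (Dec.dec-true ((A ∪ B) Subset.⊆? V) ([ A⊆ , B⊆ ]′ ∘ Subset.x∈p∪q⁻ A B))))
        (≈-sym (*-identityˡ 1#))
  ... | no A⊈ | _ = ≈-trans
        (reflexive (cong χ (Dec.dec-false ((A ∪ B) Subset.⊆? V) (λ ⊆V → A⊈ (⊆V ∘ Subset.p⊆p∪q B)))))
        (≈-sym (zeroˡ _))
  ... | yes _ | no B⊈ = ≈-trans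
        (reflexive (cong χ (Dec.dec-false ((A ∪ B) Subset.⊆? V) (λ ⊆V → B⊈ (⊆V ∘ Subset.q⊆p∪q A B)))))
        (≈-sym (zeroʳ _))

  *P-coefficient : ∀ p q T → (p *P q) T ≈
    ∑ (subsets m) (λ A → ∑ (subsets m) (λ B → χ ((A ∪ B) ≟S T) ⊗ (p A ⊗ q B)))
  *P-coefficient p q T = ≈-trans
    (sum-concatMap _ (subsets m))
    (∑-cong (subsets m) (λ A → ∑-cong (subsets m) (λ B → if≈χ ((A ∪ B) ≟S T) _)))

  eval-* : ∀ V p q → eval V (p *P q) ≈ eval V p ⊗ eval V q
  eval-* V p q = begin
    ∑ Ω (λ T → monomial V T ⊗ (p *P q) T)
      ≈⟨ ∑-cong Ω (λ T → begin
           monomial V T ⊗ (p *P q) T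
             ≈⟨ *-congˡ (*P-coefficient p q T) ⟩
           monomial V T ⊗ ∑ Ω (λ A → ∑ Ω (λ B → χ ((A ∪ B) ≟S T) ⊗ (p A ⊗ q B)))
             ≈⟨ ∑-*ˡ Ω _ _ ⟨
           ∑ Ω (λ A → monomial V T ⊗ ∑ Ω (λ B → χ ((A ∪ B) ≟S T) ⊗ (p A ⊗ q B)))
             ≈⟨ ∑-cong Ω (λ A → ≈-trans (≈-sym (∑-*ˡ Ω _ _)) (∑-cong Ω (λ B → x∙yz≈y∙xz _ _ _))) ⟩
           ∑ Ω (λ A → ∑ Ω (λ B → χ ((A ∪ B) ≟S T) ⊗ (monomial V T ⊗ (p A ⊗ q B)))) ∎) ⟩
    ∑ Ω (λ T → ∑ Ω (λ A → ∑ Ω (λ B → χ ((A ∪ B) ≟S T) ⊗ (monomial V T ⊗ (p A ⊗ q B)))))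
      ≈⟨ ∑-swap Ω Ω _ ⟩
    ∑ Ω (λ A → ∑ Ω (λ T → ∑ Ω (λ B → χ ((A ∪ B) ≟S T) ⊗ (monomial V T ⊗ (p A ⊗ q B)))))
      ≈⟨ ∑-cong Ω (λ A → begin
           ∑ Ω (λ T → ∑ Ω (λ B → χ ((A ∪ B) ≟S T) ⊗ (monomial V T ⊗ (p A ⊗ q B))))
             ≈⟨ ∑-swap Ω Ω _ ⟩
           ∑ Ω (λ B → ∑ Ω (λ T → χ ((A ∪ B) ≟S T) ⊗ (monomial V T ⊗ (p A ⊗ q B))))
             ≈⟨ ∑-cong Ω (λ B → begin
                  ∑ Ω (λ T → χ ((A ∪ B) ≟S T) ⊗ (monomial V T ⊗ (p A ⊗ q B)))
                    ≈⟨ ∑-δ′ (A ∪ B) (λ T → monomial V T ⊗ (p A ⊗ q B)) ⟩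
                  monomial V (A ∪ B) ⊗ (p A ⊗ q B)
                    ≈⟨ *-congʳ (monomial-∪ V A B) ⟩
                  (monomial V A ⊗ monomial V B) ⊗ (p A ⊗ q B)
                    ≈⟨ interchange _ _ _ _ ⟩
                  (monomial V A ⊗ p A) ⊗ (monomial V B ⊗ q B) ∎) ⟩
           ∑ Ω (λ B → (monomial V A ⊗ p A) ⊗ (monomial V B ⊗ q B))
             ≈⟨ ∑-*ˡ Ω _ _ ⟩
           (monomial V A ⊗ p A) ⊗ eval V q ∎) ⟩
    ∑ Ω (λ A → (monomial V A ⊗ p A) ⊗ eval V q)
      ≈⟨ ∑-*ʳ Ω (eval V q) _ ⟩
    eval V p ⊗ eval V q ∎
    where Ω = subsets m

  eval-sumP : ∀ V ps → eval V (sumP ps) ≈ ∑ ps (eval V)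
  eval-sumP V []       = eval-const V 0#
  eval-sumP V (p ∷ ps) = ≈-trans (eval-+ V p (sumP ps)) (+-congˡ (eval-sumP V ps))

  eval-nonneg : ∀ V {p} → NonnegCoeffs p → 0# ⊑ eval V p
  eval-nonneg V 0≤p = ∑-nonneg (subsets m) (λ T → *-nonneg (χ-nonneg _) (0≤p T))

-- Enumerations of subsets and of [n]

elements : ∀ {m} → Subset m → List (Fin m)
elements Vec.[]            = []
elements (true  Vec.∷ T) = Fin.zero ∷ map Fin.suc (elements T)
elements (false Vec.∷ T) = map Fin.suc (elements T)

length-elements : ∀ {m} (T : Subset m) → length (elements T) ≡ ∣ T ∣
length-elements Vec.[]            = refl
length-elements (true  Vec.∷ T) = cong suc (≡.trans (List.length-map Fin.suc (elements T)) (length-elements T))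
length-elements (false Vec.∷ T) = ≡.trans (List.length-map Fin.suc (elements T)) (length-elements T)

∈-elements : ∀ {m} {v : Fin m} {T : Subset m} → v ∈ˢ T → v ∈ elements T
∈-elements Vec.here                              = here refl
∈-elements {T = true  Vec.∷ T} (Vec.there v∈T) = there (∈-map⁺ Fin.suc (∈-elements v∈T))
∈-elements {T = false Vec.∷ T} (Vec.there v∈T) = ∈-map⁺ Fin.suc (∈-elements v∈T)

allFinL≡allFin : ∀ n → allFinL n ≡ allFin n
allFinL≡allFin zero    = refl
allFinL≡allFin (suc n) = cong (Fin.zero ∷_)
  (≡.trans (cong (map Fin.suc) (allFinL≡allFin n)) (List.map-tabulate id Fin.suc))

allFinL-unique : ∀ n → Unique (allFinL n)
allFinL-unique n = subst Unique (≡.sym (allFinL≡allFin n)) (Unique.allFin⁺ n)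

length-allFinL : ∀ n → length (allFinL n) ≡ n
length-allFinL n = ≡.trans (cong length (allFinL≡allFin n)) (List.length-tabulate id)

∈-allFinL : ∀ {n} (i : Fin n) → i ∈ allFinL n
∈-allFinL {n} i = subst (i ∈_) (≡.sym (allFinL≡allFin n)) (∈-allFin i)

-- The expectation over linear orders

module NoRefutation {c ℓ} (F : OrderedField c ℓ) (n : ℕ) where
  open OrderedField F
    renaming (_+_ to _⊕_; _*_ to _⊗_; _≤_ to infix 4 _⊑_; refl to ≈-refl; sym to ≈-sym; trans to ≈-trans)
  open IsTotalOrder isTotalOrder using (≤-respˡ-≈; ≤-respʳ-≈)
    renaming (trans to ⊑-trans; refl to ⊑-refl; reflexive to ⊑-reflexive)
  open OrderedFieldProperties F
  open LNP F n
  open Evaluation F (NVars n)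
  open Orders (Fin._≟_ {n})
  open RingProperties ring using (-‿distribʳ-*; -‿involutive; -‿+-comm; -0#≈0#; -1*x≈-x)
  open CommutativeSemigroupProperties *-commutativeSemigroup using (x∙yz≈y∙xz)

  -- The blocks of `P` and `S` variables are deliberately merged: a linear order gives both
  -- variables with the same indices the same value.
  pair : Fin (NVars n) → Fin n × Fin n
  pair v = remQuot n ([ id , id ]′ (splitAt (n * n) v))

  pair-varP : ∀ i j → pair (varP i j) ≡ (i , j)
  pair-varP i j rewrite Fin.splitAt-↑ˡ (n * n) (combine i j) (n * n) = Fin.remQuot-combine i j

  pair-varS : ∀ i j → pair (varS i j) ≡ (i , j)
  pair-varS i j rewrite Fin.splitAt-↑ʳ (n * n) (n * n) (combine i j) = Fin.remQuot-combine i j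

  truth : List (Fin n) → Fin n × Fin n → Bool
  truth σ (i , j) = before σ i j

  -- Under a linear order, P_{i,j} and S_{i,j} both say that i comes before j.
  valuation : List (Fin n) → Subset (NVars n)
  valuation σ = Vec.tabulate (truth σ ∘ pair)

  Σₙ : List (List (Fin n))
  Σₙ = orders (allFinL n)

  -- The expectation without its normalising factor, which is harmless because only signs matter.
  𝔼 : Poly → Carrier
  𝔼 p = ∑ Σₙ (λ σ → eval (valuation σ) p)

  lookup-valuation : ∀ σ v → Vec.lookup (valuation σ) v ≡ truth σ (pair v)
  lookup-valuation σ v = Vec.lookup∘tabulate (truth σ ∘ pair) v

  eval-P : ∀ σ i j → eval (valuation σ) (P i j) ≈ ι ⟦ before σ i j ⟧
  eval-P σ i j = ≈-trans (eval-var (valuation σ) (varP i j)) (≈-trans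
    (reflexive (cong χ (≡.trans (lookup-valuation σ (varP i j)) (cong (truth σ) (pair-varP i j)))))
    (χ≈ι (before σ i j)))

  eval-S : ∀ σ i j → eval (valuation σ) (S i j) ≈ ι ⟦ before σ i j ⟧
  eval-S σ i j = ≈-trans (eval-var (valuation σ) (varS i j)) (≈-trans
    (reflexive (cong χ (≡.trans (lookup-valuation σ (varS i j)) (cong (truth σ) (pair-varS i j)))))
    (χ≈ι (before σ i j)))

  preds : List (Fin n) → Fin n → ℕ
  preds = predecessors (allFinL n)

  eval-sumS : ∀ σ j → eval (valuation σ) (axiomPoly (sumS j)) ≈ ι (preds σ j) - 1#
  eval-sumS σ j = begin
    eval V (sumP (map (λ i → S i j) (allFinL n)) +P (-P (const 1#)))
      ≈⟨ eval-+ V _ _ ⟩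
    eval V (sumP (map (λ i → S i j) (allFinL n))) ⊕ eval V (-P (const 1#))
      ≈⟨ +-cong (eval-sumP V (map (λ i → S i j) (allFinL n))) (≈-trans (eval-neg V _) (-‿cong (eval-const V 1#))) ⟩
    ∑ (map (λ i → S i j) (allFinL n)) (eval V) - 1#
      ≡⟨ cong (_- 1#) (∑-map (λ i → S i j) (allFinL n) (eval V)) ⟩
    ∑ (allFinL n) (λ i → eval V (S i j)) - 1#
      ≈⟨ +-congʳ (∑-cong (allFinL n) (λ i → eval-S σ i j)) ⟩
    ∑ (allFinL n) (λ i → ι ⟦ before σ i j ⟧) - 1#
      ≈⟨ +-congʳ (ι-∑ (allFinL n) _) ⟨
    ι (preds σ j) - 1# ∎
    where
    open import Relation.Binary.Reasoning.Setoid setoid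
    V = valuation σ

  -- Meant for monomials containing S_{i,j}: wherever such a monomial is 1, `i` itself is a
  -- predecessor of `j`, whatever the degree.
  eval-sumS-nonneg : ∀ σ i j → before σ i j ≡ true → 0# ⊑ eval (valuation σ) (axiomPoly (sumS j))
  eval-sumS-nonneg σ i j i<j = ≤-respʳ-≈ (≈-sym (eval-sumS σ j))
    (≤⇒0≤- (≤-respˡ-≈ (+-identityʳ 1#) (ι-mono (1≤ (∈-allFinL i)))))
    where
    1≤ : ∀ {xs} → i ∈ xs → 1 ≤ predecessors xs σ j
    1≤ (here refl) rewrite i<j = s≤s z≤n
    1≤ (there i∈)  = ℕ.≤-trans (1≤ i∈) (ℕ.m≤n+m _ _)

  eval-trans-nonneg : ∀ σ i j k → 0# ⊑ eval (valuation σ) (axiomPoly (trans i j k))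
  eval-trans-nonneg σ i j k = ≤-respʳ-≈ (≈-sym value) (≤⇒0≤- (≤-respˡ-≈ (ι-+ b₂ b₃) (ι-mono transitive)))
    where
    open import Relation.Binary.Reasoning.Setoid setoid
    V  = valuation σ
    b₁ = ⟦ before σ i k ⟧
    b₂ = ⟦ before σ i j ⟧
    b₃ = ⟦ before σ j k ⟧
    transitive : b₂ + b₃ ≤ b₁ + 1
    transitive with before σ i j in ij | before σ j k in jk
    ... | false | b    = ℕ.≤-trans (⟦⟧≤1 b) (ℕ.m≤n+m 1 b₁)
    ... | true | false = ℕ.m≤n+m 1 b₁
    ... | true | true rewrite <ᵇ-true (ℕ.<-trans (<ᵇ-true⁻¹ (index σ i) (index σ j) ij) (<ᵇ-true⁻¹ (index σ j) (index σ k) jk)) =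
      ℕ.≤-refl
    value : eval V (axiomPoly (trans i j k)) ≈ ι (b₁ + 1) - (ι b₂ ⊕ ι b₃)
    value = begin
      eval V (((P i k +P (-P (P i j))) +P (-P (P j k))) +P const 1#)
        ≈⟨ ≈-trans (eval-+ V _ _) (+-cong (≈-trans (eval-+ V _ _) (+-congʳ (eval-+ V _ _))) (eval-const V 1#)) ⟩
      ((eval V (P i k) ⊕ eval V (-P (P i j))) ⊕ eval V (-P (P j k))) ⊕ 1#
        ≈⟨ +-congʳ (+-cong (+-cong (eval-P σ i k) (≈-trans (eval-neg V _) (-‿cong (eval-P σ i j))))
                           (≈-trans (eval-neg V _) (-‿cong (eval-P σ j k)))) ⟩
      ((ι b₁ - ι b₂) - ι b₃) ⊕ 1#
        ≈⟨ +-congʳ (≈-trans (+-assoc _ _ _) (+-congˡ (-‿+-comm _ _))) ⟩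
      (ι b₁ - (ι b₂ ⊕ ι b₃)) ⊕ 1#
        ≈⟨ ≈-trans (+-assoc _ _ _) (≈-trans (+-congˡ (+-comm _ _)) (≈-sym (+-assoc _ _ _))) ⟩
      (ι b₁ ⊕ 1#) - (ι b₂ ⊕ ι b₃)
        ≈⟨ +-congʳ (≈-trans (+-congˡ (≈-sym (+-identityʳ 1#))) (≈-sym (ι-+ b₁ 1))) ⟩
      ι (b₁ + 1) - (ι b₂ ⊕ ι b₃) ∎

  eval-diag : ∀ σ i → eval (valuation σ) (P i i) ≈ 0#
  eval-diag σ i = ≈-trans (eval-P σ i i) (reflexive (cong (ι ∘ ⟦_⟧) (irreflexive (index σ i))))
    where
    irreflexive : ∀ k → (k <ᵇ k) ≡ false
    irreflexive zero    = refl
    irreflexive (suc k) = irreflexive k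

  eval-PS : ∀ σ i j → eval (valuation σ) (axiomPoly (PS i j)) ≈ 0#
  eval-PS σ i j = ≈-trans (eval-+ V _ _) (≈-trans
    (+-cong (eval-P σ i j) (≈-trans (eval-neg V _) (-‿cong (eval-S σ i j)))) (-‿inverseʳ _))
    where V = valuation σ

  -- Multipliers of the axiom on the sum of the S_{i,j}

  -- No product x_A · S_{i,j} contributes to x_T, so only the constant term -1 does.
  sumS-coefficient : ∀ p j T → (∀ i → ¬ varS i j ∈ˢ T) → (p *P axiomPoly (sumS j)) T ≈ - p T
  sumS-coefficient p j T S∉T = begin
    (p *P q) T
      ≈⟨ *P-coefficient p q T ⟩
    ∑ Ω (λ A → ∑ Ω (λ B → χ ((A ∪ B) ≟S T) ⊗ (p A ⊗ q B)))
      ≈⟨ ∑-cong Ω (λ A → ∑-cong Ω (coefficient A)) ⟩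
    ∑ Ω (λ A → ∑ Ω (λ B → χ (B ≟S ⊥) ⊗ (χ ((A ∪ B) ≟S T) ⊗ - p A)))
      ≈⟨ ∑-cong Ω (λ A → ∑-δ ⊥ (λ B → χ ((A ∪ B) ≟S T) ⊗ - p A)) ⟩
    ∑ Ω (λ A → χ ((A ∪ ⊥) ≟S T) ⊗ - p A)
      ≈⟨ ∑-cong Ω (λ A → *-congʳ (reflexive (cong (λ A → χ (A ≟S T)) (Subset.∪-identityʳ A)))) ⟩
    ∑ Ω (λ A → χ (A ≟S T) ⊗ - p A)
      ≈⟨ ∑-δ T (λ A → - p A) ⟩
    - p T ∎
    where
    open import Relation.Binary.Reasoning.Setoid setoid
    Ω = subsets (NVars n)
    q = axiomPoly (sumS j)

    S-zero : ∀ {B} → B ⊆ T → ∀ i → S i j B ≈ 0#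
    S-zero {B} B⊆T i with Vec.≡-dec Bool._≟_ B ⁅ varS i j ⁆
    ... | yes refl = ⊥-elim (S∉T i (B⊆T (Subset.x∈⁅x⁆ (varS i j))))
    ... | no _     = ≈-refl

    sumP-zero : ∀ {B} → B ⊆ T → ∀ xs → sumP (map (λ i → S i j) xs) B ≈ 0#
    -- The empty sum is `const 0#`, an `if` with `0#` in both branches, so it reduces only after the
    -- test is decided.
    sumP-zero {B} B⊆T [] with B ≟S ⊥
    ... | true  = ≈-refl
    ... | false = ≈-refl
    sumP-zero B⊆T (i ∷ xs) = ≈-trans (+-cong (S-zero B⊆T i) (sumP-zero B⊆T xs)) (+-identityˡ 0#)

    coefficient : ∀ A B → χ ((A ∪ B) ≟S T) ⊗ (p A ⊗ q B) ≈ χ (B ≟S ⊥) ⊗ (χ ((A ∪ B) ≟S T) ⊗ - p A)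
    coefficient A B with Vec.≡-dec Bool._≟_ (A ∪ B) T
    ... | no _ = ≈-trans (zeroˡ _) (≈-sym (≈-trans (*-congˡ (zeroˡ _)) (zeroʳ _)))
    ... | yes refl = begin
      1# ⊗ (p A ⊗ q B)
        ≈⟨ *-congˡ (*-congˡ (+-cong (sumP-zero (Subset.q⊆p∪q A B) (allFinL n)) ≈-refl)) ⟩
      1# ⊗ (p A ⊗ (0# - χ (B ≟S ⊥)))
        ≈⟨ *-congˡ (*-congˡ (+-identityˡ _)) ⟩
      1# ⊗ (p A ⊗ - χ (B ≟S ⊥))
        ≈⟨ *-congˡ (≈-trans (≈-sym (-‿distribʳ-* _ _)) (-‿cong (*-comm _ _))) ⟩
      1# ⊗ - (χ (B ≟S ⊥) ⊗ p A)
        ≈⟨ *-congˡ (-‿distribʳ-* _ _) ⟩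
      1# ⊗ (χ (B ≟S ⊥) ⊗ - p A)
        ≈⟨ x∙yz≈y∙xz _ _ _ ⟩
      χ (B ≟S ⊥) ⊗ (1# ⊗ - p A) ∎

  weight : Subset (NVars n) → List (Fin n) → ℕ
  weight T σ = ⟦ does (T Subset.⊆? valuation σ) ⟧

  -- Moving `o` forward can only violate a requirement that something precede `o`, and no variable
  -- of `T` has `o` as its second index.
  weight-mono : ∀ T {o} → ¬ (o ∈ map (proj₂ ∘ pair) (elements T)) →
                ∀ {σ σ′} → Advances o σ σ′ → weight T σ ≤ weight T σ′
  weight-mono T {o} o∉ {σ} {σ′} adv with T Subset.⊆? valuation σ
  ... | no _  = z≤n
  ... | yes T⊆ = ℕ.≤-reflexive (cong ⟦_⟧ (≡.sym (Dec.dec-true (T Subset.⊆? valuation σ′) T⊆′)))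
    where
    T⊆′ : T ⊆ valuation σ′
    T⊆′ {v} v∈T = Vec.lookup⇒[]= v _ (≡.trans (lookup-valuation σ′ v) (<ᵇ-true
      (adv (proj₁ (pair v)) (proj₂ (pair v))
        (λ eq → o∉ (subst (_∈ _) eq (∈-map⁺ (proj₂ ∘ pair) (∈-elements v∈T))))
        (<ᵇ-true⁻¹ _ _ (≡.trans (≡.sym (lookup-valuation σ v)) (Vec.[]=⇒lookup (T⊆ v∈T)))))))

  -- The sum is the difference of the images of `W₁` and `W`, so it is nonnegative as soon as `j`
  -- has on average at least one predecessor among the orders satisfying x_T.
  monomial-sumS-nonneg : ∀ {d} → 2 * d + 3 ≤ n → ∀ j T → ∣ T ∣ ≤ d →
    0# ⊑ ∑ Σₙ (λ σ → monomial (valuation σ) T ⊗ eval (valuation σ) (axiomPoly (sumS j)))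
  monomial-sumS-nonneg {d} 2d+3≤n j T ∣T∣≤d =
    ≤-respʳ-≈ (≈-sym value) (≤⇒0≤- (ι-mono average))
    where
    open import Relation.Binary.Reasoning.Setoid setoid
    W W₁ : ℕ
    W  = ℕ∑.∑ Σₙ (weight T)
    W₁ = ℕ∑.∑ Σₙ (λ σ → weight T σ * preds σ j)

    average : W ≤ W₁
    average = average-predecessors d (allFinL-unique n)
      (ℕ.≤-trans 2d+3≤n (ℕ.≤-reflexive (≡.sym (length-allFinL n))))
      -- The elements that may not be moved: the second indices of the at most `d` variables of `T`,
      -- and `j`, which makes `suc d`.
      j (weight T) (j ∷ map (proj₂ ∘ pair) (elements T))
      (s≤s (ℕ.≤-trans (ℕ.≤-reflexive (≡.trans (List.length-map _ (elements T)) (length-elements T))) ∣T∣≤d))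
      (here refl)
      (λ o∉ {σ} {σ′} → weight-mono T (o∉ ∘ there) {σ} {σ′})

    pointwise : ∀ σ → monomial (valuation σ) T ⊗ eval (valuation σ) (axiomPoly (sumS j)) ≈
                ι (weight T σ * preds σ j) ⊕ - 1# ⊗ ι (weight T σ)
    pointwise σ = begin
      x ⊗ eval (valuation σ) (axiomPoly (sumS j))  ≈⟨ *-congˡ (eval-sumS σ j) ⟩
      x ⊗ (ι (preds σ j) - 1#)                     ≈⟨ distribˡ x _ _ ⟩
      x ⊗ ι (preds σ j) ⊕ x ⊗ - 1#                 ≈⟨ +-cong (χ-*-ι _ (preds σ j)) (≈-trans (*-comm x _) (*-congˡ (χ≈ι _))) ⟩
      ι (weight T σ * preds σ j) ⊕ - 1# ⊗ ι (weight T σ) ∎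
      where x = monomial (valuation σ) T

    value : ∑ Σₙ (λ σ → monomial (valuation σ) T ⊗ eval (valuation σ) (axiomPoly (sumS j))) ≈ ι W₁ - ι W
    value = begin
      ∑ Σₙ (λ σ → monomial (valuation σ) T ⊗ eval (valuation σ) (axiomPoly (sumS j)))
        ≈⟨ ∑-cong Σₙ pointwise ⟩
      ∑ Σₙ (λ σ → ι (weight T σ * preds σ j) ⊕ - 1# ⊗ ι (weight T σ))
        ≈⟨ ∑-+ Σₙ _ _ ⟩
      ∑ Σₙ (λ σ → ι (weight T σ * preds σ j)) ⊕ ∑ Σₙ (λ σ → - 1# ⊗ ι (weight T σ))
        ≈⟨ +-cong (≈-sym (ι-∑ Σₙ _)) (∑-*ˡ Σₙ (- 1#) _) ⟩
      ι W₁ ⊕ - 1# ⊗ ∑ Σₙ (ι ∘ weight T)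
        ≈⟨ +-congˡ (≈-trans (-1*x≈-x _) (-‿cong (≈-sym (ι-∑ Σₙ (weight T))))) ⟩
      ι W₁ - ι W ∎

  -- The degree bound concerns the product, so `p` may contain monomials of larger degree. Those
  -- with some S_{i,j} are nonnegative order by order, those of degree at most `d` on average, and
  -- any other monomial has coefficient zero by `sumS-coefficient`.
  𝔼-sumS-nonneg : ∀ {d} → 2 * d + 3 ≤ n → ∀ p j → NonnegCoeffs p →
                  DegreeAtMost d (p *P axiomPoly (sumS j)) → 0# ⊑ 𝔼 (p *P axiomPoly (sumS j))
  𝔼-sumS-nonneg {d} 2d+3≤n p j 0≤p deg = ≤-respʳ-≈ (≈-sym value) (∑-nonneg Ω term)
    where
    open import Relation.Binary.Reasoning.Setoid setoid
    Ω = subsets (NVars n)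
    q = axiomPoly (sumS j)
    E : Subset (NVars n) → Carrier
    E T = ∑ Σₙ (λ σ → monomial (valuation σ) T ⊗ eval (valuation σ) q)

    value : 𝔼 (p *P q) ≈ ∑ Ω (λ T → p T ⊗ E T)
    value = begin
      ∑ Σₙ (λ σ → eval (valuation σ) (p *P q))
        ≈⟨ ∑-cong Σₙ (λ σ → ≈-trans (eval-* (valuation σ) p q) (≈-trans (≈-sym (∑-*ʳ Ω _ _))
             (∑-cong Ω (λ T → ≈-trans (*-congʳ (*-comm _ (p T))) (*-assoc (p T) _ _))))) ⟩
      ∑ Σₙ (λ σ → ∑ Ω (λ T → p T ⊗ (monomial (valuation σ) T ⊗ eval (valuation σ) q)))
        ≈⟨ ∑-swap Σₙ Ω _ ⟩
      ∑ Ω (λ T → ∑ Σₙ (λ σ → p T ⊗ (monomial (valuation σ) T ⊗ eval (valuation σ) q)))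
        ≈⟨ ∑-cong Ω (λ T → ∑-*ˡ Σₙ (p T) _) ⟩
      ∑ Ω (λ T → p T ⊗ E T) ∎

    term : ∀ T → 0# ⊑ p T ⊗ E T
    term T with Fin.any? (λ i → varS i j Subset.∈? T)
    ... | yes (i , S∈T) = *-nonneg (0≤p T) (∑-nonneg Σₙ pointwise)
      where
      pointwise : ∀ σ → 0# ⊑ monomial (valuation σ) T ⊗ eval (valuation σ) q
      pointwise σ with T Subset.⊆? valuation σ
      ... | no _   = ⊑-reflexive (≈-sym (zeroˡ _))
      ... | yes T⊆ = *-nonneg 0≤1 (eval-sumS-nonneg σ i j
            (≡.trans (≡.sym (cong (truth σ) (pair-varS i j)))
              (≡.trans (≡.sym (lookup-valuation σ (varS i j))) (Vec.[]=⇒lookup (T⊆ S∈T)))))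
    ... | no S∉T with ∣ T ∣ ℕ.≤? d
    ... | yes ∣T∣≤d = *-nonneg (0≤p T) (monomial-sumS-nonneg 2d+3≤n j T ∣T∣≤d)
    ... | no ∣T∣≰d  = ⊑-reflexive (≈-sym (≈-trans (*-congʳ pT≈0) (zeroˡ _)))
      where
      pT≈0 : p T ≈ 0#
      pT≈0 = begin
        p T             ≈⟨ -‿involutive (p T) ⟨
        - (- p T)       ≈⟨ -‿cong (sumS-coefficient p j T (λ i S∈T → S∉T (i , S∈T))) ⟨
        - (p *P q) T    ≈⟨ -‿cong (deg T (ℕ.≰⇒> ∣T∣≰d)) ⟩
        - 0#            ≈⟨ -0#≈0# ⟩
        0#              ∎

  -- Applying the expectation to a refutation

  𝔼-product-nonneg : ∀ {p q} → NonnegCoeffs p → (∀ σ → 0# ⊑ eval (valuation σ) q) → 0# ⊑ 𝔼 (p *P q)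
  𝔼-product-nonneg {p} {q} 0≤p 0≤q = ∑-nonneg Σₙ (λ σ →
    ≤-respʳ-≈ (≈-sym (eval-* (valuation σ) p q)) (*-nonneg (eval-nonneg (valuation σ) 0≤p) (0≤q σ)))

  𝔼-axiom-nonneg : ∀ {d} → 2 * d + 3 ≤ n → ∀ a p → NonnegCoeffs p →
                   DegreeAtMost d (p *P axiomPoly a) → 0# ⊑ 𝔼 (p *P axiomPoly a)
  𝔼-axiom-nonneg 2d+3≤n (sumS j) p 0≤p deg = 𝔼-sumS-nonneg 2d+3≤n p j 0≤p deg
  𝔼-axiom-nonneg _ (diag≥ i) p 0≤p _ =
    𝔼-product-nonneg 0≤p (λ σ → ⊑-reflexive (≈-sym (eval-diag σ i)))
  𝔼-axiom-nonneg _ (diag≤ i) p 0≤p _ =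
    𝔼-product-nonneg 0≤p (λ σ → ⊑-reflexive
      (≈-sym (≈-trans (eval-neg _ _) (≈-trans (-‿cong (eval-diag σ i)) -0#≈0#))))
  𝔼-axiom-nonneg _ (trans i j k) p 0≤p _ = 𝔼-product-nonneg 0≤p (λ σ → eval-trans-nonneg σ i j k)
  𝔼-axiom-nonneg _ (PS i j) p 0≤p _ =
    𝔼-product-nonneg 0≤p (λ σ → ⊑-reflexive (≈-sym (eval-PS σ i j)))

  𝔼-+ : ∀ p q → 𝔼 (p +P q) ≈ 𝔼 p ⊕ 𝔼 q
  𝔼-+ p q = ≈-trans (∑-cong Σₙ (λ σ → eval-+ (valuation σ) p q)) (∑-+ Σₙ _ _)

  𝔼-sumP-nonneg : (xs : List A) (f : A → Poly) → (∀ {x} → x ∈ xs → 0# ⊑ 𝔼 (f x)) → 0# ⊑ 𝔼 (sumP (map f xs))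
  𝔼-sumP-nonneg []       f 0≤f = ∑-nonneg Σₙ (λ σ → ⊑-reflexive (≈-sym (eval-const (valuation σ) 0#)))
  𝔼-sumP-nonneg (x ∷ xs) f 0≤f = ≤-respʳ-≈ (≈-sym (𝔼-+ (f x) (sumP (map f xs))))
    (+-nonneg (0≤f (here refl)) (𝔼-sumP-nonneg xs f (0≤f ∘ there)))

  𝔼-square-nonneg : ∀ r → 0# ⊑ 𝔼 (r *P r)
  𝔼-square-nonneg r = ∑-nonneg Σₙ (λ σ →
    ≤-respʳ-≈ (≈-sym (eval-* (valuation σ) r r)) (square-nonneg _))

  𝔼-1≱0 : ¬ 0# ⊑ 𝔼 (const (- 1#))
  𝔼-1≱0 0≤ = 0≰-1 (⊑-trans
    (≤-respʳ-≈ (∑-cong Σₙ (λ σ → eval-const (valuation σ) (- 1#))) 0≤)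
    (∑-const≤member (∈-orders (allFinL n)) -1≤0))

  -- Under `𝔼` every summand on the right of the identity becomes nonnegative, whereas -1 does not.
  -- The hypothesis is d ≤ (n - 3) / 2 written without division.
  no-refutation : ∀ {d} → 2 * d + 3 ≤ n → ¬ SASquaresRefutation d
  no-refutation 2d+3≤n R = 𝔼-1≱0 (≤-respʳ-≈
    (≈-sym (∑-cong Σₙ (λ σ → eval-cong (valuation σ) identity)))
    (≤-respʳ-≈ (≈-sym (𝔼-+ _ _)) (+-nonneg
      (𝔼-sumP-nonneg linTerms _ (λ { {a , p} ∈lin → 𝔼-axiom-nonneg 2d+3≤n a p (nonneg ∈lin) (degLin ∈lin) }))
      (𝔼-sumP-nonneg squares _ (λ {r} _ → 𝔼-square-nonneg r)))))
    where open SASquaresRefutation R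

theorem11 : ∀ {c ℓ} (F : OrderedField c ℓ) (n d : ℕ) → 2 * d + 3 ≤ n →
    ¬ LNP.SASquaresRefutation F n d
theorem11 F n d = NoRefutation.no-refutation F n
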